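{- For all integers $t\geqslant s\geqslant 7$, $C(n,K_{s,t})=\Omega(n^{2/3})$ as $n\to\infty$.
   Context: For a graph $H$ and a positive integer $n$, $C(n,H)$ denotes the minimum integer $k$ such that there exist $n$ colorings $f_v:E(K_n)\to[k]$, one for each vertex $v\in V(K_n)$ (the colorings need not be proper), with the following property: for every copy $T$ of $H$ in $K_n$, there is a vertex $v\in V(T)$ such that $f_v$ assigns pairwise distinct colors to all edges of $E(T)$. $K_{s,t}$ is the complete bipartite graph with parts of sizes $s$ and $t$. -}

module Defs where

open import Data.Nat using (ℕ; _≤_; _^_; _*_)
open import Data.Fin using (Fin)
open import Data.Product using (Σ; _×_; ∃; _,_)
open import Data.Sum using (_⊎_)
open import Relation.Binary.PropositionalEquality using (_≡_; _≢_)
open import Relation.Nullary using (¬_)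
open import Function.Definitions using (Injective)

-- Vertices of K_n are Fin n.  A colouring of E(K_n) with k colours is
-- represented as a symmetric function Fin n → Fin n → Fin k; only its
-- values on pairs x ≢ y (the edges {x,y}) matter.
Coloring : ℕ → ℕ → Set
Coloring n k = Fin n → Fin n → Fin k

Symmetric : ∀ {n k} → Coloring n k → Set
Symmetric {n} f = ∀ (x y : Fin n) → f x y ≡ f y x

-- A copy of K_{s,t} in K_n, given by an embedding: injective maps of the
-- two parts with disjoint images.  Edges of the copy are {A i, B j}.
record CopyKst (n s t : ℕ) : Set where
  field
    A : Fin s → Fin n
    B : Fin t → Fin n
    A-inj : Injective _≡_ _≡_ A
    B-inj : Injective _≡_ _≡_ B
    disjoint : ∀ (i : Fin s) (j : Fin t) → A i ≢ B j
open CopyKst public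

InCopy : ∀ {n s t} → Fin n → CopyKst n s t → Set
InCopy {s = s} {t} v T = (Σ (Fin s) λ i → v ≡ A T i) ⊎ (Σ (Fin t) λ j → v ≡ B T j)

Rainbow : ∀ {n s t k} → Coloring n k → CopyKst n s t → Set
Rainbow {s = s} {t} f T =
  ∀ (i i' : Fin s) (j j' : Fin t) →
    ¬ ((i ≡ i') × (j ≡ j')) → f (A T i) (B T j) ≢ f (A T i') (B T j')

Good : (n s t k : ℕ) → (Fin n → Coloring n k) → Set
Good n s t k fam =
  (∀ v → Symmetric (fam v)) ×
  (∀ (T : CopyKst n s t) → Σ (Fin n) λ v → InCopy v T × Rainbow (fam v) T)

-- "C(n, K_{s,t}) ≤ k" witnessed: such a family with k colours exists.
Achievable : (n s t k : ℕ) → Set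
Achievable n s t k = Σ (Fin n → Coloring n k) (Good n s t k)

{-# OPTIONS --safe #-}
module Submission where

-- Let n be much larger than k^{3/2}.  Fix a vertex a and a set D of 2k other
-- vertices.  Every f_v makes at least k of the 2k edges from a to D share
-- their colour with another one, so double counting yields b ≢ b' in D such
-- that f_v (ab) ≡ f_v (ab') for a set S of order n / k vertices v outside
-- {a} ∪ D.  Take disjoint P, Q ⊆ S with |P| = |Q| = p and p² > 3k.  At most k
-- edges between P and Q have a unique colour under a given colouring, hence
-- some edge has a repeated colour under each of f_a, f_b and f_b'.  A copy
-- containing that edge and its three repetitions, with a and vertices of P on
-- one side and b, b' and vertices of Q on the other, is rainbow for no f_v.

open import Defs
open import Data.Empty using (⊥-elim)
open import Data.Fin using (Fin; zero; suc; _↑ˡ_; _↑ʳ_; splitAt; combine; remQuot; punchIn; punchOut; inject≤)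
open import Data.Fin.Properties using (_≟_; any?; all?; ¬∀⟶∃¬; pigeonhole; <⇒≢; suc-injective; punchIn-injective; punchInᵢ≢i; punchIn-punchOut; inject≤-injective; combine-injective; combine-remQuot; ↑ˡ-injective; ↑ʳ-injective; splitAt-↑ˡ; splitAt-↑ʳ)
open import Data.List using (List; []; _∷_; length; tabulate)
open import Data.List.Membership.Propositional using (_∈_)
open import Data.List.Membership.Propositional.Properties using (∈-tabulate⁺)
open import Data.List.Relation.Unary.Any using (here; there)
open import Data.Nat using (ℕ; zero; suc; _+_; _*_; _∸_; _^_; _≤_; _<_; z≤n; s≤s; s≤s⁻¹; NonZero; >-nonZero; _<?_; _/_)
open import Data.Nat.DivMod using (m/n*n≤m; m≡m%n+[m/n]*n; m%n<n)
open import Data.Nat.Properties hiding (_≟_; suc-injective; <⇒≢)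
open import Data.Nat.Tactic.RingSolver using (solve-∀)
open import Data.Product using (Σ; ∃; ∃₂; _×_; _,_; proj₁; proj₂)
open import Data.Sum using (_⊎_; inj₁; inj₂)
open import Function using (_∘_)
open import Function.Definitions using (Injective)
open import Relation.Binary.PropositionalEquality using (_≡_; _≢_; refl; sym; trans; cong; cong₂)
open import Relation.Nullary using (¬_; Dec; yes; no; contradiction)
open import Relation.Nullary.Decidable using (¬?; _×-dec_)
open import Relation.Unary using (Pred; Decidable)
open import Level using (0ℓ)

open import Algebra.Properties.CommutativeMonoid.Sum +-0-commutativeMonoid using (sum; ∑-comm; ∑-distrib-+; sum-cong-≗)

-- Finite sums, averaging and counting.

sum-mono-≤ : ∀ {m} {f g : Fin m → ℕ} → (∀ i → f i ≤ g i) → sum f ≤ sum g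
sum-mono-≤ {zero}  f≤g = z≤n
sum-mono-≤ {suc m} f≤g = +-mono-≤ (f≤g zero) (sum-mono-≤ (f≤g ∘ suc))

*≤sum : ∀ {m c} {f : Fin m → ℕ} → (∀ i → c ≤ f i) → m * c ≤ sum f
*≤sum {zero}  c≤f = z≤n
*≤sum {suc m} c≤f = +-mono-≤ (c≤f zero) (*≤sum (c≤f ∘ suc))

term≤sum : ∀ {m} (f : Fin m → ℕ) i → f i ≤ sum f
term≤sum f zero    = m≤m+n _ _
term≤sum f (suc i) = ≤-trans (term≤sum (f ∘ suc) i) (m≤n+m _ _)

*<sum⇒∃< : ∀ {m} c (f : Fin m → ℕ) → m * c < sum f → ∃ λ i → c < f i
*<sum⇒∃< {zero}  c f ()
*<sum⇒∃< {suc m} c f lt with c <? f zero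
... | yes c<f₀ = zero , c<f₀
... | no  c≮f₀ with *<sum⇒∃< c (f ∘ suc) (+-cancelˡ-< c _ _ (<-≤-trans lt (+-monoˡ-≤ _ (≮⇒≥ c≮f₀))))
...   | i , c<fᵢ = suc i , c<fᵢ

indicator : ∀ {P : Set} → Dec P → ℕ
indicator (yes _) = 1
indicator (no  _) = 0

indicator-yes : ∀ {P : Set} (P? : Dec P) → P → 1 ≤ indicator P?
indicator-yes (yes _) p = ≤-refl
indicator-yes (no ¬p) p = contradiction p ¬p

count : ∀ {m} {P : Pred (Fin m) 0ℓ} → Decidable P → ℕ
count P? = sum (indicator ∘ P?)

-- Scan the indices in order, skipping failures and stopping after `q` successes. This turns
-- numerical bounds into actual distinct vertices.
count-enumerate : ∀ {m q} {P : Pred (Fin m) 0ℓ} (P? : Decidable P) → q ≤ count P? →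
  ∃ λ (σ : Fin q → Fin m) → Injective _≡_ _≡_ σ × (∀ i → P (σ i))
count-enumerate {zero}  {zero}  P? q≤ = (λ ()) , (λ { {()} }) , λ ()
count-enumerate {suc m} {q}     P? q≤ with P? zero
count-enumerate {suc m} {q}     P? q≤ | no _ with count-enumerate (P? ∘ suc) q≤
... | σ , σ-inj , Pσ = suc ∘ σ , σ-inj ∘ suc-injective , Pσ
count-enumerate {suc m} {zero}  P? q≤ | yes _ = (λ ()) , (λ { {()} }) , λ ()
count-enumerate {suc m} {suc q} {P} P? (s≤s q≤) | yes P₀ with count-enumerate (P? ∘ suc) q≤
... | σ , σ-inj , Pσ = σ′ , σ′-inj , Pσ′
  where
  σ′ : Fin (suc q) → Fin (suc m)
  σ′ zero    = zero
  σ′ (suc i) = suc (σ i)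
  σ′-inj : Injective _≡_ _≡_ σ′
  σ′-inj {zero}  {zero}  _  = refl
  σ′-inj {suc _} {suc _} eq = cong suc (σ-inj (suc-injective eq))
  Pσ′ : ∀ i → P (σ′ i)
  Pσ′ zero    = P₀
  Pσ′ (suc i) = Pσ i

count-∁ : ∀ {m} {P : Pred (Fin m) 0ℓ} (P? : Decidable P) → m ≤ count (¬? ∘ P?) + count P?
count-∁ {m} P? = begin
  m                                                          ≡⟨ *-identityʳ m ⟨
  m * 1                                                      ≤⟨ *≤sum (λ i → split (P? i)) ⟩
  sum (λ i → indicator (¬? (P? i)) + indicator (P? i))       ≡⟨ ∑-distrib-+ (indicator ∘ ¬? ∘ P?) (indicator ∘ P?) ⟩
  count (¬? ∘ P?) + count P?                                 ∎
  where
  open ≤-Reasoning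
  split : ∀ {P : Set} (P? : Dec P) → 1 ≤ indicator (¬? P?) + indicator P?
  split (yes _) = s≤s z≤n
  split (no  _) = s≤s z≤n

-- Repeated colours.

Collide : ∀ {m k} → (Fin m → Fin k) → Fin m → Fin m → Set
Collide g i j = i ≢ j × g i ≡ g j

collide? : ∀ {m k} (g : Fin m → Fin k) i → Decidable (Collide g i)
collide? g i j = ¬? (i ≟ j) ×-dec (g i ≟ g j)

Repeated : ∀ {m k} → (Fin m → Fin k) → Pred (Fin m) 0ℓ
Repeated g i = ∃ (Collide g i)

repeated? : ∀ {m k} (g : Fin m → Fin k) → Decidable (Repeated g)
repeated? g i = any? (collide? g i)

-- An unrepeated index is the sole owner of its colour, and there are only `k` colours to own.
count-unrepeated≤ : ∀ {m k} (g : Fin m → Fin k) → count (¬? ∘ repeated? g) ≤ k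
count-unrepeated≤ {k = k} g = ≮⇒≥ λ k< →
  let σ , σ-inj , unrepeated = count-enumerate (¬? ∘ repeated? g) k<
      i , j , i<j , same     = pigeonhole (n<1+n k) (g ∘ σ)
  in unrepeated i (σ j , <⇒≢ i<j ∘ σ-inj , same)

∸≤collisions : ∀ {m k} (g : Fin m → Fin k) → m ∸ k ≤ sum (λ i → count (collide? g i))
∸≤collisions {m} {k} g = begin
  m ∸ k                            ≤⟨ m≤n+o⇒m∸n≤o m k (≤-trans (count-∁ (repeated? g)) (+-monoˡ-≤ _ (count-unrepeated≤ g))) ⟩
  count (repeated? g)              ≤⟨ sum-mono-≤ (λ i → bound i (repeated? g i)) ⟩
  sum (λ i → count (collide? g i)) ∎
  where
  open ≤-Reasoning
  bound : ∀ i (r : Dec (Repeated g i)) → indicator r ≤ count (collide? g i)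
  bound i (yes (j , c)) = ≤-trans (indicator-yes (collide? g i j) c) (term≤sum _ j)
  bound i (no _)        = z≤n

-- Count triples of a colouring and an ordered colliding pair: each colouring contributes at least
-- `m ∸ k`. With the sum over colourings moved innermost, average over `i` and then over `j`.
popular-collision : ∀ {r m k} (g : Fin r → Fin m → Fin k) c → m * (m * c) < r * (m ∸ k) →
  ∃₂ λ i j → c < count (λ v → collide? (g v) i j)
popular-collision {r} {m} {k} g c lt =
  let i , <i = *<sum⇒∃< (m * c) (λ i → sum (λ j → sum (λ v → hit v i j))) (<-≤-trans lt total)
      j , <j = *<sum⇒∃< c (λ j → sum (λ v → hit v i j)) <i
  in i , j , <j
  where
  open ≤-Reasoning
  hit : Fin r → Fin m → Fin m → ℕ
  hit v i j = indicator (collide? (g v) i j)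
  total : r * (m ∸ k) ≤ sum (λ i → sum (λ j → sum (λ v → hit v i j)))
  total = begin
    r * (m ∸ k)                                 ≤⟨ *≤sum (λ v → ∸≤collisions (g v)) ⟩
    sum (λ v → sum (λ i → sum (λ j → hit v i j))) ≡⟨ ∑-comm (λ v i → sum (hit v i)) ⟩
    sum (λ i → sum (λ v → sum (λ j → hit v i j))) ≡⟨ sum-cong-≗ (λ i → ∑-comm (λ v j → hit v i j)) ⟩
    sum (λ i → sum (λ j → sum (λ v → hit v i j))) ∎

-- An index failing for some colouring is recorded by that colouring together
-- with the colour, and no two indices share such a record.
commonly-repeated : ∀ {l m k} (g : Fin l → Fin m → Fin k) → l * k < m → ∃ λ i → ∀ c → Repeated (g c) i
commonly-repeated {l} {m} {k} g lt with any? (λ i → all? (λ c → repeated? (g c) i))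
... | yes found = found
... | no  none  =
  let i , j , i<j , same = pigeonhole lt record-of
      c≡ , g≡            = combine-injective (bad i) _ (bad j) _ same
  in ⊥-elim (proj₂ (failure i) (j , <⇒≢ i<j , trans g≡ (cong (λ c → g c j) (sym c≡))))
  where
  failure : ∀ i → ∃ λ c → ¬ Repeated (g c) i
  failure i = ¬∀⟶∃¬ _ _ (λ c → repeated? (g c) i) (λ all → none (i , all))
  bad : Fin m → Fin l
  bad = proj₁ ∘ failure
  record-of : Fin m → Fin (l * k)
  record-of i = combine (bad i) (g (bad i) i)

-- Injections whose image covers a given list.

punchOut-list : ∀ {p} (x : Fin (suc p)) (ys : List (Fin (suc p))) →
  ∃ λ zs → length zs ≤ length ys × (∀ {y} → y ∈ ys → x ≡ y ⊎ ∃ λ z → z ∈ zs × punchIn x z ≡ y)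
punchOut-list x [] = [] , z≤n , λ ()
punchOut-list x (y ∷ ys) with punchOut-list x ys | x ≟ y
... | zs , len , cov | yes x≡y = zs , m≤n⇒m≤1+n len , λ { (here refl) → inj₁ x≡y ; (there y∈) → cov y∈ }
... | zs , len , cov | no  x≢y = punchOut x≢y ∷ zs , s≤s len , cov′
  where
  cov′ : ∀ {y′} → y′ ∈ y ∷ ys → x ≡ y′ ⊎ ∃ λ z → z ∈ punchOut x≢y ∷ zs × punchIn x z ≡ y′
  cov′ (here refl) = inj₂ (_ , here refl , punchIn-punchOut x≢y)
  cov′ (there y∈) with cov y∈
  ... | inj₁ eq            = inj₁ eq
  ... | inj₂ (z , z∈ , eq) = inj₂ (z , there z∈ , eq)

-- The head becomes the first value and is deleted from the ground set; `punchIn` then keeps all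
-- later values away from it. Repetitions in the list are dropped on the way, and surplus places are
-- filled by `inject≤`.
injection-through : ∀ {p u} (xs : List (Fin p)) → length xs ≤ u → u ≤ p →
  ∃ λ (τ : Fin u → Fin p) → Injective _≡_ _≡_ τ × (∀ {x} → x ∈ xs → ∃ λ i → τ i ≡ x)
injection-through [] _ u≤p = (λ i → inject≤ i u≤p) , inject≤-injective u≤p u≤p _ _ , λ ()
injection-through {suc p} {suc u} (x ∷ ys) (s≤s len) (s≤s u≤p) with punchOut-list x ys
... | zs , len′ , cov with injection-through zs (≤-trans len′ len) u≤p
... | τ , τ-inj , τ-cov = τ′ , τ′-inj , τ′-cov
  where
  τ′ : Fin (suc u) → Fin (suc p)
  τ′ zero    = x
  τ′ (suc i) = punchIn x (τ i)
  τ′-inj : Injective _≡_ _≡_ τ′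
  τ′-inj {zero}  {zero}  _  = refl
  τ′-inj {zero}  {suc j} eq = contradiction (sym eq) (punchInᵢ≢i x (τ j))
  τ′-inj {suc i} {zero}  eq = contradiction eq (punchInᵢ≢i x (τ i))
  τ′-inj {suc i} {suc j} eq = cong suc (τ-inj (punchIn-injective x _ _ eq))
  τ′-cov : ∀ {y} → y ∈ x ∷ ys → ∃ λ i → τ′ i ≡ y
  τ′-cov (here refl) = zero , refl
  τ′-cov (there y∈) with cov y∈
  ... | inj₁ x≡y = zero , x≡y
  ... | inj₂ (z , z∈ , eq) = let i , τi≡z = τ-cov z∈ in suc i , trans (cong (punchIn x) τi≡z) eq

↑ˡ≢↑ʳ : ∀ {m n} (i : Fin m) (j : Fin n) → i ↑ˡ n ≢ m ↑ʳ j
↑ˡ≢↑ʳ {m} {n} i j eq with trans (sym (splitAt-↑ˡ m i n)) (trans (cong (splitAt m) eq) (splitAt-↑ʳ m n j))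
... | ()

-- The copy that is rainbow for none of its vertices.

module Obstruction {k p r s t : ℕ} (fam : Fin (suc ((k + k) + r)) → Coloring (suc ((k + k) + r)) k)
  (4≤s : 4 ≤ s) (4≤t : 4 ≤ t) (s≤p : s ≤ p) (t≤p : t ≤ p)
  (3k<p² : 3 * k < p * p) (many : (k + k) * ((k + k) * (p + p)) < r * ((k + k) ∸ k)) where

  -- Vertex `zero` is a, the next `k + k` form D, and S is sought among the last `r`. In this module
  -- `s` and `t` count only the places left for S, after a has taken one place and b, b' two.
  V : Set
  V = Fin (suc ((k + k) + r))

  a : V
  a = zero

  d : Fin (k + k) → V
  d i = suc (i ↑ˡ r)

  rest : Fin r → V
  rest v = suc ((k + k) ↑ʳ v)

  d-injective : Injective _≡_ _≡_ d
  d-injective = ↑ˡ-injective r _ _ ∘ suc-injective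

  rest-injective : Injective _≡_ _≡_ rest
  rest-injective = ↑ʳ-injective (k + k) _ _ ∘ suc-injective

  d≢rest : ∀ i v → d i ≢ rest v
  d≢rest i v = ↑ˡ≢↑ʳ i v ∘ suc-injective

  star : Fin r → Fin (k + k) → Fin k
  star v i = fam (rest v) a (d i)

  cherry : ∃₂ λ i j → p + p < count (λ v → collide? (star v) i j)
  cherry = popular-collision star (p + p) many

  ib ib′ : Fin (k + k)
  ib  = proj₁ cherry
  ib′ = proj₁ (proj₂ cherry)

  killers : ∃ λ (σ : Fin (suc (p + p)) → Fin r) → Injective _≡_ _≡_ σ × (∀ i → Collide (star (σ i)) ib ib′)
  killers = count-enumerate (λ v → collide? (star v) ib ib′) (proj₂ (proj₂ cherry))

  σ : Fin (suc (p + p)) → Fin r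
  σ = proj₁ killers

  σ-injective : Injective _≡_ _≡_ σ
  σ-injective = proj₁ (proj₂ killers)

  σ-kills : ∀ i → Collide (star (σ i)) ib ib′
  σ-kills = proj₂ (proj₂ killers)

  -- These are P and Q. Index `zero` stays outside both: it is a member of S available for every
  -- `p`, and `ib≢ib′` is read off from it.
  left right : Fin p → Fin (suc (p + p))
  left  x = suc (x ↑ˡ p)
  right y = suc (p ↑ʳ y)

  centre : Fin 3 → V
  centre zero             = a
  centre (suc zero)       = d ib
  centre (suc (suc zero)) = d ib′

  endˡ endʳ : Fin (p * p) → Fin p
  endˡ e = proj₁ (remQuot {p} p e)
  endʳ e = proj₂ (remQuot {p} p e)

  grid : Fin 3 → Fin (p * p) → Fin k
  grid c e = fam (centre c) (rest (σ (left (endˡ e)))) (rest (σ (right (endʳ e))))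

  common : ∃ λ e → ∀ c → Repeated (grid c) e
  common = commonly-repeated grid 3k<p²

  -- The common edge and one partner for each of the three centres. Partners may coincide or share
  -- ends, so each side has at most four ends to cover; hence `4 ≤ s` and `4 ≤ t`.
  edge : Fin 4 → Fin (p * p)
  edge zero    = proj₁ common
  edge (suc c) = proj₁ (proj₂ common c)

  through : ∀ {u} (end : Fin (p * p) → Fin p) → 4 ≤ u → u ≤ p →
    ∃ λ (τ : Fin u → Fin p) → Injective _≡_ _≡_ τ × (∀ h → ∃ λ i → τ i ≡ end (edge h))
  through end 4≤u u≤p =
    let τ , τ-inj , cov = injection-through (tabulate (end ∘ edge)) 4≤u u≤p
    in τ , τ-inj , λ h → cov (∈-tabulate⁺ {f = end ∘ edge} h)

  α : Fin s → Fin p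
  α = proj₁ (through endˡ 4≤s s≤p)

  β : Fin t → Fin p
  β = proj₁ (through endʳ 4≤t t≤p)

  α-injective : Injective _≡_ _≡_ α
  α-injective = proj₁ (proj₂ (through endˡ 4≤s s≤p))

  β-injective : Injective _≡_ _≡_ β
  β-injective = proj₁ (proj₂ (through endʳ 4≤t t≤p))

  partA : Fin (suc s) → V
  partA zero    = a
  partA (suc i) = rest (σ (left (α i)))

  partB : Fin (suc (suc t)) → V
  partB zero          = d ib
  partB (suc zero)    = d ib′
  partB (suc (suc j)) = rest (σ (right (β j)))

  partA-injective : Injective _≡_ _≡_ partA
  partA-injective {zero}  {zero}  _  = refl
  partA-injective {suc i} {suc j} eq =
    cong suc (α-injective (↑ˡ-injective p _ _ (suc-injective (σ-injective (rest-injective eq)))))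

  ib≢ib′ : ib ≢ ib′
  ib≢ib′ = proj₁ (σ-kills zero)

  partB-injective : Injective _≡_ _≡_ partB
  partB-injective {zero}        {zero}        _  = refl
  partB-injective {zero}        {suc zero}    eq = contradiction (d-injective eq) ib≢ib′
  partB-injective {zero}        {suc (suc j)} eq = contradiction eq (d≢rest _ _)
  partB-injective {suc zero}    {zero}        eq = contradiction (sym (d-injective eq)) ib≢ib′
  partB-injective {suc zero}    {suc zero}    _  = refl
  partB-injective {suc zero}    {suc (suc j)} eq = contradiction eq (d≢rest _ _)
  partB-injective {suc (suc i)} {zero}        eq = contradiction (sym eq) (d≢rest _ _)
  partB-injective {suc (suc i)} {suc zero}    eq = contradiction (sym eq) (d≢rest _ _)
  partB-injective {suc (suc i)} {suc (suc j)} eq =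
    cong (λ j → suc (suc j)) (β-injective (↑ʳ-injective p _ _ (suc-injective (σ-injective (rest-injective eq)))))

  parts-disjoint : ∀ i j → partA i ≢ partB j
  parts-disjoint zero    zero          ()
  parts-disjoint zero    (suc zero)    ()
  parts-disjoint zero    (suc (suc j)) ()
  parts-disjoint (suc i) zero          eq = d≢rest _ _ (sym eq)
  parts-disjoint (suc i) (suc zero)    eq = d≢rest _ _ (sym eq)
  parts-disjoint (suc i) (suc (suc j)) eq =
    ↑ˡ≢↑ʳ _ _ (suc-injective (σ-injective (rest-injective eq)))

  copy : CopyKst (suc ((k + k) + r)) (suc s) (suc (suc t))
  copy = record
    { A = partA ; B = partB ; A-inj = partA-injective ; B-inj = partB-injective
    ; disjoint = parts-disjoint }

  killer-not-rainbow : ∀ i → ¬ Rainbow (fam (rest (σ i))) copy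
  killer-not-rainbow i rainbow = rainbow zero zero zero (suc zero) (λ ()) (proj₂ (σ-kills i))

  -- Both the common edge and its partner under `c` lie in the copy, because `α` and `β` pass
  -- through all their ends.
  centre-not-rainbow : ∀ c → ¬ Rainbow (fam (centre c)) copy
  centre-not-rainbow c rainbow = rainbow
    (suc (posˡ zero)) (suc (posˡ (suc c))) (suc (suc (posʳ zero))) (suc (suc (posʳ (suc c))))
    distinct (trans (colour zero) (trans (proj₂ collision) (sym (colour (suc c)))))
    where
    collision : Collide (grid c) (edge zero) (edge (suc c))
    collision = proj₂ (proj₂ common c)
    posˡ : Fin 4 → Fin s
    posˡ h = proj₁ (proj₂ (proj₂ (through endˡ 4≤s s≤p)) h)
    posʳ : Fin 4 → Fin t
    posʳ h = proj₁ (proj₂ (proj₂ (through endʳ 4≤t t≤p)) h)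
    αpos : ∀ h → α (posˡ h) ≡ endˡ (edge h)
    αpos h = proj₂ (proj₂ (proj₂ (through endˡ 4≤s s≤p)) h)
    βpos : ∀ h → β (posʳ h) ≡ endʳ (edge h)
    βpos h = proj₂ (proj₂ (proj₂ (through endʳ 4≤t t≤p)) h)
    colour : ∀ h → fam (centre c) (partA (suc (posˡ h))) (partB (suc (suc (posʳ h)))) ≡ grid c (edge h)
    colour h = cong₂ (λ x y → fam (centre c) (rest (σ (left x))) (rest (σ (right y)))) (αpos h) (βpos h)
    -- Positions determine the edge, so equal positions would make the edge its own partner.
    edge-at : ∀ h → combine (α (posˡ h)) (β (posʳ h)) ≡ edge h
    edge-at h = trans (cong₂ combine (αpos h) (βpos h)) (combine-remQuot {p} p (edge h))
    distinct : ¬ (Fin.suc (posˡ zero) ≡ suc (posˡ (suc c)) ×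
                  Fin.suc (Fin.suc (posʳ zero)) ≡ suc (suc (posʳ (suc c))))
    distinct (eqˡ , eqʳ) = proj₁ collision (trans (sym (edge-at zero)) (trans
      (cong₂ (λ i j → combine (α i) (β j)) (suc-injective eqˡ) (suc-injective (suc-injective eqʳ)))
      (edge-at (suc c))))

  not-good : ¬ Good (suc ((k + k) + r)) (suc s) (suc (suc t)) k fam
  not-good (_ , good) with good copy
  ... | _ , inj₁ (zero          , refl) , rainbow = centre-not-rainbow zero rainbow
  ... | _ , inj₁ (suc i         , refl) , rainbow = killer-not-rainbow _ rainbow
  ... | _ , inj₂ (zero          , refl) , rainbow = centre-not-rainbow (suc zero) rainbow
  ... | _ , inj₂ (suc zero      , refl) , rainbow = centre-not-rainbow (suc (suc zero)) rainbow
  ... | _ , inj₂ (suc (suc j)   , refl) , rainbow = killer-not-rainbow _ rainbow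

-- 12 k p ≤ n leaves more than 8 k p vertices besides a and the 2k vertices of D.
not-achievable : ∀ {n k p s t} → 1 ≤ k → 4 ≤ s → 4 ≤ t → s ≤ p → t ≤ p → 3 * k < p * p →
  p * (12 * k) ≤ n → ¬ Achievable n (suc s) (suc (suc t)) k
not-achievable {n} {k} {p} {s} {t} 1≤k 4≤s 4≤t s≤p t≤p 3k<p² big (fam , good) =
  let o , n≡ = m≤n⇒∃[o]m+o≡n (≤-trans fits big)
  in absurd o (trans (cong suc (sym (+-assoc (k + k) _ o))) n≡) fam good
  where
  open ≤-Reasoning
  fits : suc ((k + k) + suc (8 * (k * p))) ≤ p * (12 * k)
  fits = begin
    suc ((k + k) + suc (8 * (k * p)))        ≡⟨ e₁ k (8 * (k * p)) ⟩
    k * 2 + 1 * 2 + 8 * (k * p)              ≤⟨ +-monoˡ-≤ (8 * (k * p)) (+-monoʳ-≤ (k * 2) (*-monoˡ-≤ 2 1≤k)) ⟩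
    k * 2 + k * 2 + 8 * (k * p)              ≡⟨ e₂ k (8 * (k * p)) ⟩
    4 * (k * 1) + 8 * (k * p)                ≤⟨ +-monoˡ-≤ (8 * (k * p)) (*-monoʳ-≤ 4 (*-monoʳ-≤ k (≤-trans (≤-trans (s≤s z≤n) 4≤s) s≤p))) ⟩
    4 * (k * p) + 8 * (k * p)                ≡⟨ e₃ k p ⟩
    p * (12 * k)                             ∎
    where
    e₁ : ∀ k z → suc ((k + k) + suc z) ≡ k * 2 + 1 * 2 + z
    e₁ = solve-∀
    e₂ : ∀ k z → k * 2 + k * 2 + z ≡ 4 * (k * 1) + z
    e₂ = solve-∀
    e₃ : ∀ k p → 4 * (k * p) + 8 * (k * p) ≡ p * (12 * k)
    e₃ = solve-∀
  many : ∀ o → (k + k) * ((k + k) * (p + p)) < (suc (8 * (k * p)) + o) * ((k + k) ∸ k)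
  many o = begin-strict
    (k + k) * ((k + k) * (p + p))              ≡⟨ e k p ⟩
    8 * (k * p) * k                            <⟨ *-monoˡ-< k {{>-nonZero 1≤k}} (m≤m+n (suc (8 * (k * p))) o) ⟩
    (suc (8 * (k * p)) + o) * k                ≡⟨ cong ((suc (8 * (k * p)) + o) *_) (m+n∸n≡m k k) ⟨
    (suc (8 * (k * p)) + o) * ((k + k) ∸ k)    ∎
    where
    e : ∀ k p → (k + k) * ((k + k) * (p + p)) ≡ 8 * (k * p) * k
    e = solve-∀
  -- Here `n` is a variable of its own, so that matching on `refl` retypes `fam`; the `o` surplus
  -- vertices join the last block.
  absurd : ∀ o {n} → suc ((k + k) + (suc (8 * (k * p)) + o)) ≡ n → (fam : Fin n → Coloring n k) →
    ¬ Good n (suc s) (suc (suc t)) k fam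
  absurd o refl fam = Obstruction.not-good fam 4≤s 4≤t s≤p t≤p 3k<p² (many o)

-- From the obstruction to the bound on n.

n≤[1+n/d]*d : ∀ n d .{{_ : NonZero d}} → n ≤ suc (n / d) * d
n≤[1+n/d]*d n d = ≤-trans (≤-reflexive (m≡m%n+[m/n]*n n d)) (+-monoˡ-≤ _ (<⇒≤ (m%n<n n d)))

-- With `p` bounded, n is at most linear in k, and a square is at most the cube for a positive base.
n²≤-of-p<M : ∀ {n k p M} → 1 ≤ k → n ≤ suc p * (12 * k) → p < M → n ^ 2 ≤ (144 * M * k) ^ 3
n²≤-of-p<M {n} {k} {p} {M} 1≤k n≤ p<M = begin
  n ^ 2               ≤⟨ ^-monoˡ-≤ 2 (begin
    n                   ≤⟨ n≤ ⟩
    suc p * (12 * k)    ≤⟨ *-monoˡ-≤ (12 * k) p<M ⟩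
    M * (12 * k)        ≡⟨ e M k ⟩
    12 * (M * k)        ≤⟨ *-monoˡ-≤ (M * k) (m≤m+n 12 132) ⟩
    144 * (M * k)       ≡⟨ *-assoc 144 M k ⟨
    144 * M * k         ∎) ⟩
  (144 * M * k) ^ 2   ≤⟨ ^-monoʳ-≤ (144 * M * k) {{>-nonZero pos}} (n≤1+n 2) ⟩
  (144 * M * k) ^ 3   ∎
  where
  open ≤-Reasoning
  e : ∀ M k → M * (12 * k) ≡ 12 * (M * k)
  e = solve-∀
  pos : 0 < 144 * M * k
  pos = *-mono-≤ {1} {_} {1} (*-mono-≤ {1} {144} {1} (s≤s z≤n) (≤-trans (s≤s z≤n) p<M)) 1≤k

-- This is where the exponent 2/3 arises: n ≤ 24pk and p² ≤ 3k give n² ≤ 576p²k² ≤ 1728k³.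
n²≤-of-p²≤3k : ∀ {n k p M} → 1 ≤ M → 1 ≤ p → n ≤ suc p * (12 * k) → p * p ≤ 3 * k →
  n ^ 2 ≤ (144 * M * k) ^ 3
n²≤-of-p²≤3k {n} {k} {p} {M} 1≤M 1≤p n≤ p²≤3k = begin
  n ^ 2                          ≤⟨ ^-monoˡ-≤ 2 n≤ ⟩
  (suc p * (12 * k)) ^ 2         ≤⟨ ^-monoˡ-≤ 2 (*-monoˡ-≤ (12 * k) (+-monoˡ-≤ p 1≤p)) ⟩
  ((p + p) * (12 * k)) ^ 2       ≡⟨ e₁ p k 12 ⟩
  p * p * (4 * (12 * 12 * (k * k))) ≤⟨ *-monoˡ-≤ (4 * (12 * 12 * (k * k))) p²≤3k ⟩
  3 * k * (4 * (12 * 12 * (k * k))) ≡⟨ e₂ k 12 ⟩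
  -- 1728 + 2984256 = 144³.
  12 * (12 * 12) * k ^ 3         ≤⟨ *-monoˡ-≤ (k ^ 3) (≤-trans (m≤m+n 1728 2984256) (^-monoˡ-≤ 3 (*-monoʳ-≤ 144 1≤M))) ⟩
  (144 * M) ^ 3 * k ^ 3          ≡⟨ e₃ (144 * M) k ⟩
  (144 * M * k) ^ 3              ∎
  where
  open ≤-Reasoning
  e₁ : ∀ p k c → (p + p) * (c * k) * ((p + p) * (c * k) * 1) ≡ p * p * (4 * (c * c * (k * k)))
  e₁ = solve-∀
  e₂ : ∀ k c → 3 * k * (4 * (c * c * (k * k))) ≡ 12 * (c * c) * (k * (k * (k * 1)))
  e₂ = solve-∀
  e₃ : ∀ x k → x * (x * (x * 1)) * (k * (k * (k * 1))) ≡ x * k * (x * k * (x * k * 1))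
  e₃ = solve-∀

n²≤-of-achievable : ∀ {s t n k} → 4 ≤ s → 4 ≤ t → 1 ≤ n → Achievable n (suc s) (suc (suc t)) k →
  n ^ 2 ≤ (144 * (s + t) * k) ^ 3
-- Without colours not even one value of a colouring exists.
n²≤-of-achievable {n = suc n} {zero} _ _ _ (fam , _) with fam zero zero zero
... | ()
n²≤-of-achievable {s} {t} {n} {k@(suc _)} 4≤s 4≤t _ ach =
  -- The quotient is the largest `p` that `not-achievable` admits for this n. If `p` is too small
  -- for its other hypotheses, n is already small in terms of k.
  by-cases (n / (12 * k)) (n≤[1+n/d]*d n (12 * k)) (m/n*n≤m n (12 * k))
  where
  1≤k : 1 ≤ k
  1≤k = s≤s z≤n
  1≤M : 1 ≤ s + t
  1≤M = ≤-trans (s≤s z≤n) (≤-trans 4≤s (m≤m+n s t))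
  by-cases : ∀ p → n ≤ suc p * (12 * k) → p * (12 * k) ≤ n → n ^ 2 ≤ (144 * (s + t) * k) ^ 3
  by-cases p n≤ ≤n with p <? s + t | 3 * k <? p * p
  ... | yes p<M | _         = n²≤-of-p<M 1≤k n≤ p<M
  ... | no  p≮M | no  3k≮p² = n²≤-of-p²≤3k 1≤M (≤-trans 1≤M (≮⇒≥ p≮M)) n≤ (≮⇒≥ 3k≮p²)
  ... | no  p≮M | yes 3k<p² = contradiction ach
    (not-achievable 1≤k 4≤s 4≤t (≤-trans (m≤m+n s t) (≮⇒≥ p≮M)) (≤-trans (m≤n+m t s) (≮⇒≥ p≮M)) 3k<p² ≤n)

theorem3 : (s t : ℕ) → 7 ≤ s → s ≤ t →
    Σ ℕ λ d → Σ ℕ λ N → (n : ℕ) → N ≤ n → (k : ℕ) →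
    Achievable n s t k → n ^ 2 ≤ (suc d * k) ^ 3
-- The parts are stripped of the places of a and of b, b'. The threshold 1 serves to exclude k = 0.
theorem3 (suc s) (suc (suc t)) (s≤s 6≤s) (s≤s s≤1+t) =
  144 * (s + t) , 1 , λ n 1≤n k ach →
    ≤-trans (n²≤-of-achievable (≤-trans (m≤m+n 4 2) 6≤s) (≤-trans (n≤1+n 4) (s≤s⁻¹ (≤-trans 6≤s s≤1+t))) 1≤n ach)
            (^-monoˡ-≤ 3 (*-monoˡ-≤ k (n≤1+n (144 * (s + t)))))
theorem3 (suc s) (suc zero) (s≤s 6≤s) (s≤s s≤0) = contradiction (≤-trans 6≤s s≤0) λ ()
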